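{- For a string $T$ of length $n > d$ over an alphabet $\Sigma$ of size $\sigma$, $$\mathcal{S}(T,d) \in O(\min\{d,\sigma\}\, n),$$ that is, there is an absolute constant $C$ with $\mathcal{S}(T,d) \le C\min\{d,\sigma\}\,n$ for all such $T$, $d$, $\sigma$. This upper bound is tight when $n-d \in \Omega(n)$; that is, for every constant $c \in (0,1)$ there is a constant $c' > 0$ such that for all positive integers $\sigma, d, n$ with $d < n$ and $n-d \ge c\,n$, there exists a string $T$ of length $n$ over an alphabet of size $\sigma$ with $$\mathcal{S}(T,d) \ge c' \min\{d,\sigma\}\, n.$$
   Context: Strings are finite sequences over a finite alphabet $\Sigma$; positions are 1-indexed and $T[i..j]$ denotes the substring of $T$ from position $i$ to position $j$. A string $w$ occurs in $S$ if it is a (contiguous) substring of $S$; the empty string occurs in every string. A non-empty string $w \in \Sigma^*$ is a minimal absent word (MAW) for $S$ if $w$ does not occur in $S$ but every proper substring of $w$ occurs in $S$ (in particular a single character of $\Sigma$ not occurring in $S$ is a MAW for $S$). $\mathsf{MAW}(S)$ is the set of all MAWs for $S$ relative to $\Sigma$. $\bigtriangleup$ denotes symmetric difference. For a string $T$ of length $n$ and window length $d$ with $1 \le d < n$, $$\mathcal{S}(T,d) = \sum_{i=1}^{n-d} |\mathsf{MAW}(T[i..i+d-1]) \bigtriangleup \mathsf{MAW}(T[i+1..i+d])|.$$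
   Formalization: The tightness half is stated for alphabets of size σ ≥ 2 instead of all positive σ, because for σ = 1 all windows coincide, so S(T,d) = 0 and the claimed lower bound fails; the constants c and c' are taken rational, which is equivalent. -}

module Defs where

open import Data.Fin.Base using (Fin)
import Data.Fin.Properties as Fin
open import Data.Integer.Base using (+_)
open import Data.List.Base
  using (List; []; _∷_; length; map; take; drop; upTo; filter; deduplicate;
         cartesianProductWith; allFin)
open import Data.List.Membership.Propositional using (_∈_)
open import Data.List.Membership.Propositional.Properties
  using (∈-cartesianProductWith⁺; ∈-allFin; ∈-filter⁺; ∈-filter⁻; ∈-deduplicate⁺;
         ∈-deduplicate⁻)
open import Data.List.Properties using (≡-dec)
open import Data.List.Relation.Binary.Infix.Heterogeneous using (Infix; there)
import Data.List.Relation.Binary.Infix.Heterogeneous.Properties as Infix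
open import Data.List.Relation.Binary.Pointwise using (≡⇒Pointwise-≡)
open import Data.List.Relation.Unary.All using (all?; lookup; tabulate)
open import Data.List.Relation.Unary.Any as Any using ()
open import Data.List.Relation.Unary.Unique.Propositional using (Unique)
open import Data.List.Relation.Unary.Unique.DecPropositional.Properties using (deduplicate-!)
open import Data.Nat.Base using (ℕ; zero; suc; _+_; _∸_; _≤_; z≤n; s≤s)
open import Data.Nat.ListAction using (sum)
open import Data.Nat.Properties using (m≤n⇒m≤n+o; m≤n⇒m≤o+n; 1+n≢n)
open import Data.Product.Base using (_×_; _,_; proj₁; proj₂)
open import Data.Rational.Base using (ℚ; _/_)
open import Data.Sum.Base using (inj₁; inj₂)
open import Data.Vec.Base using (Vec; toList)
open import Level using (Level; _⊔_; 0ℓ)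
open import Relation.Binary.Definitions using (DecidableEquality)
open import Relation.Binary.PropositionalEquality
  using (_≡_; _≢_; refl; sym; cong)
open import Relation.Nullary using (¬_)
open import Relation.Nullary.Decidable using (Dec; map′; ¬?; _×-dec_; _→-dec_)
open import Relation.Unary using (Pred; Decidable; _∪_; _∖_)
open import Relation.Unary.Properties using (_∪?_)

private
  variable
    a p : Level
    σ : ℕ

------------------------------------------------------------------------
-- Finite subsets and their cardinality

record Finite {A : Set a} (P : Pred A p) : Set (a ⊔ p) where
  field
    elements : List A
    unique   : Unique elements
    sound    : ∀ {x} → x ∈ elements → P x
    complete : ∀ {x} → P x → x ∈ elements

card : {A : Set a} {P : Pred A p} → Finite P → ℕ
card F = length (Finite.elements F)

infixr 6 _△_

_△_ : {A : Set a} → Pred A p → Pred A p → Pred A p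
P △ Q = (P ∖ Q) ∪ (Q ∖ P)

------------------------------------------------------------------------
-- Strings and minimal absent words

-- The alphabet of size σ is Fin σ.

String : ℕ → Set
String σ = List (Fin σ)

infix 4 _OccursIn_

_OccursIn_ : String σ → String σ → Set
w OccursIn S = Infix _≡_ w S

ProperSubstring : String σ → String σ → Set
ProperSubstring v w = v OccursIn w × v ≢ w

MAW : String σ → Pred (String σ) 0ℓ
MAW S w = w ≢ []
        × ¬ (w OccursIn S)
        × (∀ v → ProperSubstring v w → v OccursIn S)

------------------------------------------------------------------------
-- MAW S △ MAW S′ is finite: a minimal absent word for S has length at
-- most 1 + |S|, and being one is decidable.  Only the specification in
-- Finite matters, so the enumeration itself is kept abstract.

private
  _≟_ : DecidableEquality (String σ)
  _≟_ = ≡-dec Fin._≟_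

  words : ∀ σ → ℕ → List (String σ)
  words σ zero    = [] ∷ []
  words σ (suc m) = [] ∷ cartesianProductWith _∷_ (allFin σ) (words σ m)

  ∈-words : ∀ {m} (w : String σ) → length w ≤ m → w ∈ words σ m
  ∈-words {m = zero}  []      _       = Any.here refl
  ∈-words {m = suc m} []      _       = Any.here refl
  ∈-words {m = suc m} (x ∷ w) (s≤s l) =
    Any.there (∈-cartesianProductWith⁺ _∷_ (∈-allFin x) (∈-words w l))

occursIn? : (w S : String σ) → Dec (w OccursIn S)
occursIn? = Infix.infix? Fin._≟_

MAW? : (S : String σ) → Decidable (MAW S)
MAW? {σ} S w = ¬? (w ≟ []) ×-dec ¬? (occursIn? w S) ×-dec
  map′ (λ all v v⊂w → lookup all (∈-words v (Infix.length-mono (proj₁ v⊂w))) v⊂w)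
       (λ f → tabulate (λ {v} _ → f v))
       (all? (λ v → (occursIn? v w ×-dec ¬? (v ≟ w)) →-dec occursIn? v S)
             (words σ (length w)))

MAW-length : (S : String σ) {w : String σ} → MAW S w → length w ≤ suc (length S)
MAW-length S {[]}    _             = z≤n
MAW-length S {x ∷ u} (_ , _ , sub) = s≤s (Infix.length-mono (sub u (there u⊑u , u≢w)))
  where
  u⊑u : u OccursIn u
  u⊑u = Infix.fromPointwise (≡⇒Pointwise-≡ refl)
  u≢w : u ≢ x ∷ u
  u≢w eq = 1+n≢n (cong length (sym eq))

abstract
  MAW-△-finite : (S S′ : String σ) → Finite (MAW S △ MAW S′)
  MAW-△-finite {σ} S S′ = record
    { elements = deduplicate _≟_ (filter △? ws)
    ; unique   = deduplicate-! _≟_ (filter △? ws)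
    ; sound    = λ w∈ → proj₂ (∈-filter⁻ △? {xs = ws} (∈-deduplicate⁻ _≟_ (filter △? ws) w∈))
    ; complete = λ {w} w∈△ → ∈-deduplicate⁺ _≟_ (∈-filter⁺ △? (∈-words w (bound w∈△)) w∈△)
    }
    where
    m : ℕ
    m = suc (length S) + suc (length S′)
    ws : List (String σ)
    ws = words σ m
    △? : Decidable (MAW S △ MAW S′)
    △? = (λ w → MAW? S w ×-dec ¬? (MAW? S′ w)) ∪? (λ w → MAW? S′ w ×-dec ¬? (MAW? S w))
    bound : ∀ {w} → (MAW S △ MAW S′) w → length w ≤ m
    bound (inj₁ (maw , _)) = m≤n⇒m≤n+o (suc (length S′)) (MAW-length S maw)
    bound (inj₂ (maw , _)) = m≤n⇒m≤o+n (suc (length S)) (MAW-length S′ maw)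

------------------------------------------------------------------------
-- The total number of changes in a sliding window

-- Positions are 0-indexed: window T d i is T[i+1..i+d] in 1-indexed notation.

window : ∀ {n} → Vec (Fin σ) n → (d i : ℕ) → String σ
window T d i = take d (drop i (toList T))

𝒮 : ∀ {n} → Vec (Fin σ) n → ℕ → ℕ
𝒮 {n = n} T d =
  sum (map (λ i → card (MAW-△-finite (window T d i) (window T d (suc i)))) (upTo (n ∸ d)))

fromℕ : ℕ → ℚ
fromℕ n = + n / 1

{-# OPTIONS --safe #-}

-- Upper bound.  Slide the window from a S to S b through S.  Appending b to S deletes at most one
-- MAW and adds words of two kinds: w₀ y, where w₀ is the shortest suffix of S b absent from S, and
-- x u b, where u is a suffix of S that is left-special in S (preceded there by two distinct
-- characters) and u b is absent from S.  Only min(d , σ) characters are available for x and y, so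
-- if there are k such u, the step costs O(min(d , σ)) (1 + k).  Let φ S be the number of
-- left-special suffixes of S.  Each of those counted by φ (S b), other than the empty one, is u b
-- with u left-special in S and u b present in S, so k + φ (S b) ≤ 1 + φ S; and φ does not increase
-- when the first character is dropped.  Hence the k add up to O(n).  Removing a from a S is the
-- mirror image, with the window sliding backwards.
--
-- Lower bound.  Put distinct markers x₁ , x₂ , … , used cyclically, at distance g with zeros in
-- between, such that a marker entering the window is absent from it while Ω(min(d , σ)) others are
-- present.  When x enters, xᵢ 0ʲ x becomes a MAW for all j < g and all xᵢ but the last one, which
-- makes Ω(min(d , σ)) changes per position on average.  For bounded min(d , σ), an alternating
-- word already changes a MAW at every step.
module Submission where

open import Defs
open import Data.Bool.Base using (true; false)
open import Data.Fin.Base using (Fin; zero; suc; toℕ; inject≤)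
import Data.Fin.Properties as Fin
import Data.Integer.Base as ℤ
import Data.Integer.Properties as ℤₚ
open import Data.List.Base hiding (sum)
open import Data.List.Membership.Propositional using (_∈_)
open import Data.List.Membership.Propositional.Properties
open import Data.List.Properties hiding (sum-++)
open import Data.List.Relation.Binary.Infix.Heterogeneous
  using (there; MkView; toView; _++ⁱ_; _ⁱ++_)
import Data.List.Relation.Binary.Infix.Heterogeneous.Properties as Infix
open import Data.List.Relation.Binary.Pointwise using (≡⇒Pointwise-≡; Pointwise-≡⇒≡)
open import Data.List.Relation.Unary.All as All using ([]; _∷_)
open import Data.List.Relation.Unary.AllPairs using ([]; _∷_)
open import Data.List.Relation.Unary.Any using (here; there)
open import Data.List.Relation.Unary.Unique.DecPropositional.Properties using (deduplicate-!)
open import Data.List.Relation.Unary.Unique.Propositional using (Unique)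
open import Data.List.Relation.Unary.Unique.Propositional.Properties
  using (cartesianProductWith⁺; allFin⁺)
open import Data.Nat.Base
open import Data.Nat.DivMod
open import Data.Nat.ListAction using (sum)
open import Data.Nat.ListAction.Properties using (sum-++)
open import Data.Nat.Properties
open import Data.Nat.Tactic.RingSolver using (solve-∀)
open import Data.Product.Base using (Σ-syntax; _×_; _,_; ∃; ∃₂; map₂; proj₁; proj₂)
open import Data.Rational.Base as ℚ using (ℚ; 0ℚ; 1ℚ)
import Data.Rational.Properties as ℚₚ
import Data.Rational.Unnormalised.Base as ℚᵘ
import Data.Rational.Unnormalised.Properties as ℚᵘₚ
open import Data.Sum.Base using (_⊎_; inj₁; inj₂; [_,_]′)
open import Data.Vec.Base using (Vec; []; _∷_; toList)
open import Data.Vec.Properties using (length-toList)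
open import Function.Base using (_∘_; id)
open import Relation.Binary.PropositionalEquality
open import Relation.Nullary using (¬_; yes; no; does; contradiction)
open import Relation.Nullary.Decidable using (¬?; _×-dec_)
open import Relation.Unary using (Pred; Decidable)

private
  variable
    σ : ℕ
    u v w S : String σ
    x y b c : Fin σ

-- Counting elements and suffixes of lists

module _ {a} {A : Set a} where

  -- Each head of `xs` is cut out of `ys` at one of its positions; by uniqueness the remaining
  -- elements of `xs` still lie in what is left.
  length-⊆ : {xs ys : List A} → Unique xs → (∀ {z} → z ∈ xs → z ∈ ys) →
             length xs ≤ length ys
  length-⊆ [] _ = z≤n
  length-⊆ {x ∷ xs} {ys} (x∉ ∷ uniq) sub with ps , qs , refl ← ∈-∃++ (sub (here refl)) = begin
    suc (length xs)              ≤⟨ s≤s (length-⊆ uniq remain) ⟩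
    suc (length (ps ++ qs))      ≡⟨ cong suc (length-++ ps) ⟩
    suc (length ps + length qs)  ≡⟨ +-suc (length ps) (length qs) ⟨
    length ps + suc (length qs)  ≡⟨ length-++ ps ⟨
    length (ps ++ x ∷ qs)        ∎
    where
    open ≤-Reasoning
    remain : ∀ {z} → z ∈ xs → z ∈ ps ++ qs
    remain z∈ with ∈-++⁻ ps (sub (there z∈))
    ... | inj₁ z∈ps          = ∈-++⁺ˡ z∈ps
    ... | inj₂ (there z∈qs)  = ∈-++⁺ʳ ps z∈qs
    ... | inj₂ (here refl)   = contradiction refl (All.lookup x∉ z∈)

  module _ {p q r} {P : Pred A p} {Q : Pred A q} {R : Pred A r}
           (P? : Decidable P) (Q? : Decidable Q) (R? : Decidable R)
           (P⇒R : ∀ {z} → P z → R z) (Q⇒R : ∀ {z} → Q z → R z)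
           (disjoint : ∀ {z} → P z → ¬ Q z) where

    length-filter-disjoint : ∀ xs →
      length (filter P? xs) + length (filter Q? xs) ≤ length (filter R? xs)
    length-filter-disjoint [] = z≤n
    length-filter-disjoint (x ∷ xs) with P? x | Q? x | R? x | length-filter-disjoint xs
    ... | yes Px | yes Qx | _      | _  = contradiction Qx (disjoint Px)
    ... | yes Px | no _   | no ¬Rx | _  = contradiction (P⇒R Px) ¬Rx
    ... | no _   | yes Qx | no ¬Rx | _  = contradiction (Q⇒R Qx) ¬Rx
    ... | yes _  | no _   | yes _  | ih = s≤s ih
    ... | no _   | yes _  | yes _  | ih = ≤-trans (≤-reflexive (+-suc _ _)) (s≤s ih)
    ... | no _   | no _   | yes _  | ih = m≤n⇒m≤1+n ih
    ... | no _   | no _   | no _   | ih = ih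

  module _ {p q} {P : Pred A p} {Q : Pred A q} (P? : Decidable P) (Q? : Decidable Q)
           (P⇒Q : ∀ {z} → P z → Q z) where

    length-filter-mono : ∀ xs → length (filter P? xs) ≤ length (filter Q? xs)
    length-filter-mono [] = z≤n
    length-filter-mono (x ∷ xs) with P? x | Q? x | length-filter-mono xs
    ... | yes _  | yes _  | ih = s≤s ih
    ... | yes Px | no ¬Qx | _  = contradiction (P⇒Q Px) ¬Qx
    ... | no _   | yes _  | ih = m≤n⇒m≤1+n ih
    ... | no _   | no _   | ih = ih

  length-filter-map : ∀ {b p} {B : Set b} {P : Pred A p} (P? : Decidable P) (f : B → A) xs →
                      length (filter P? (map f xs)) ≡ length (filter (P? ∘ f) xs)
  length-filter-map P? f [] = refl
  length-filter-map P? f (x ∷ xs) with does (P? (f x))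
  ... | true  = cong suc (length-filter-map P? f xs)
  ... | false = length-filter-map P? f xs

  length-tails : (xs : List A) → length (tails xs) ≡ suc (length xs)
  length-tails []       = refl
  length-tails (x ∷ xs) = cong suc (length-tails xs)

  ∈-tails : ∀ ps {xs : List A} → xs ∈ tails (ps ++ xs)
  ∈-tails []       = here refl
  ∈-tails (_ ∷ ps) = there (∈-tails ps)

  tails-∷ʳ : ∀ (xs : List A) z → tails (xs ∷ʳ z) ≡ map (_∷ʳ z) (tails xs) ∷ʳ []
  tails-∷ʳ []       z = refl
  tails-∷ʳ (x ∷ xs) z = cong ((x ∷ xs ∷ʳ z) ∷_) (tails-∷ʳ xs z)

-- Occurrences

occurs-refl : w OccursIn w
occurs-refl = Infix.fromPointwise (≡⇒Pointwise-≡ refl)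

occurs-++ : (p w s : String σ) → w OccursIn p ++ w ++ s
occurs-++ p w s = p ++ⁱ (occurs-refl ⁱ++ s)

occurs-split : w OccursIn S → ∃₂ λ p s → S ≡ p ++ w ++ s
occurs-split w⊑S with MkView p eq s ← toView w⊑S =
  p , s , cong (λ v → p ++ v ++ s) (sym (Pointwise-≡⇒≡ eq))

occurs-trans : u OccursIn v → v OccursIn w → u OccursIn w
occurs-trans {u = u} u⊑v v⊑w
  with p , s , refl ← occurs-split u⊑v | q , t , refl ← occurs-split v⊑w =
  q ++ⁱ ((p ++ⁱ (occurs-refl ⁱ++ s)) ⁱ++ t)

[]-occurs : [] OccursIn S
[]-occurs = occurs-refl ⁱ++ _

occurs-∷ : w OccursIn S → w OccursIn x ∷ S
occurs-∷ = there

occurs-∷ʳ : w OccursIn S → w OccursIn S ∷ʳ b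
occurs-∷ʳ w⊑S = w⊑S ⁱ++ _

suffix-occurs : (p : String σ) → S ≡ p ++ w → w OccursIn S
suffix-occurs p refl = p ++ⁱ occurs-refl

-- The part `s` to the right of the occurrence decides: if it is nonempty it contains the final `b`,
-- and the occurrence lies within `S`; if it is empty, `w` is a suffix.
∷ʳ-occurs-split : w OccursIn S ∷ʳ b → w OccursIn S ⊎ ∃ λ p → S ∷ʳ b ≡ p ++ w
∷ʳ-occurs-split {w = w} {S = S} w⊑Sb with occurs-split w⊑Sb
... | p , s , eq with initLast s
...   | []      = inj₂ (p , trans eq (cong (p ++_) (++-identityʳ w)))
...   | s′ ∷ʳ′ c = inj₁ (subst (w OccursIn_) (sym (∷ʳ-injectiveˡ S (p ++ w ++ s′) (begin
  S ∷ʳ _             ≡⟨ eq ⟩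
  p ++ w ++ s′ ∷ʳ c  ≡⟨ cong (p ++_) (++-assoc w s′ (c ∷ [])) ⟨
  p ++ (w ++ s′) ∷ʳ c ≡⟨ ++-assoc p (w ++ s′) (c ∷ []) ⟨
  (p ++ w ++ s′) ∷ʳ c ∎))) (occurs-++ p w s′))
  where open ≡-Reasoning

∷ʳ-suffix-init : ∀ {c} (p : String σ) → S ∷ʳ b ≡ p ++ w ∷ʳ c → S ≡ p ++ w × b ≡ c
∷ʳ-suffix-init {S = S} {w = w} {c = c} p eq =
  ∷ʳ-injective S (p ++ w) (trans eq (sym (++-assoc p w (c ∷ []))))

∷ʳ-occurs-∷ʳ⁻ : w ∷ʳ c OccursIn S ∷ʳ b → w OccursIn S
∷ʳ-occurs-∷ʳ⁻ {c = c} wc⊑ with ∷ʳ-occurs-split wc⊑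
... | inj₁ wc⊑S      = occurs-trans (occurs-∷ʳ occurs-refl) wc⊑S
... | inj₂ (p , eq)  = suffix-occurs p (proj₁ (∷ʳ-suffix-init p eq))

-- An occurrence that reaches both ends is the whole word, so a proper substring misses the first or
-- the last letter.
∷-∷ʳ-occurs-split : v OccursIn x ∷ u ∷ʳ y → v ≢ x ∷ u ∷ʳ y →
                    v OccursIn x ∷ u ⊎ v OccursIn u ∷ʳ y
∷-∷ʳ-occurs-split {x = x} {u = u} v⊑ v≢ with ∷ʳ-occurs-split {S = x ∷ u} v⊑
... | inj₁ v⊑xu           = inj₁ v⊑xu
... | inj₂ ([] , eq)      = contradiction (sym eq) v≢
... | inj₂ (_ ∷ p , eq)   = inj₂ (suffix-occurs p (∷-injectiveʳ eq))

occurs-∈ : x ∈ w → w OccursIn S → x ∈ S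
occurs-∈ {w = w} x∈w w⊑S with p , s , refl ← occurs-split w⊑S = ∈-++⁺ʳ p (∈-++⁺ˡ x∈w)

-- Minimal absent words

-- Every proper substring lies in one of the two maximal ones, so minimality has to be checked only
-- there.
MAW-intro : ¬ (x ∷ u ∷ʳ y OccursIn S) → x ∷ u OccursIn S → u ∷ʳ y OccursIn S →
            MAW S (x ∷ u ∷ʳ y)
MAW-intro w⋢S xu⊑S uy⊑S = (λ ()) , w⋢S , λ v (v⊑w , v≢w) →
  [ (λ v⊑xu → occurs-trans v⊑xu xu⊑S) , (λ v⊑uy → occurs-trans v⊑uy uy⊑S) ]′
    (∷-∷ʳ-occurs-split v⊑w v≢w)

MAW-init : ∀ {c} → MAW S (w ∷ʳ c) → w OccursIn S
MAW-init {w = w} {c} (_ , _ , sub) = sub w (occurs-∷ʳ occurs-refl , λ eq → m≢1+m+n (length w)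
  (trans (cong length eq) (trans (length-++ w) (+-suc _ 0))))

MAW-tail : MAW S (x ∷ w) → w OccursIn S
MAW-tail {w = w} (_ , _ , sub) =
  sub w (occurs-∷ occurs-refl , λ eq → 1+n≢n (cong length (sym eq)))

-- Letters and absent suffixes of a word

chars : String σ → List (Fin σ)
chars = deduplicate Fin._≟_

length-chars : (S : String σ) → length (chars S) ≤ length S ⊓ σ
length-chars {σ} S = ⊓-glb
  (length-⊆ (deduplicate-! Fin._≟_ S) (∈-deduplicate⁻ Fin._≟_ S))
  (subst (length (chars S) ≤_) (length-tabulate id)
    (length-⊆ (deduplicate-! Fin._≟_ S) (λ {z} _ → ∈-allFin z)))

-- The scan runs from long to short and stops at the first nonempty suffix of `L` whose tail occurs
-- in `S`. This is the shortest absent suffix if `L` itself is absent from `S`, as `S ∷ʳ b` is by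
-- its length. The value `[]` arises only for empty `L`.
shortestAbsentSuffix : (S L : String σ) → String σ
shortestAbsentSuffix S [] = []
shortestAbsentSuffix S (x ∷ L) with occursIn? L S
... | yes _ = x ∷ L
... | no  _ = shortestAbsentSuffix S L

-- The scan cannot stop before `x ∷ u`: the tail of any longer suffix contains `x ∷ u` and is
-- therefore absent from `S`.
shortestAbsentSuffix-unique : ∀ p → ¬ (x ∷ u OccursIn S) → u OccursIn S →
                              shortestAbsentSuffix S (p ++ x ∷ u) ≡ x ∷ u
shortestAbsentSuffix-unique {u = u} {S = S} [] _ u⊑S with occursIn? u S
... | yes _   = refl
... | no u⋢S  = contradiction u⊑S u⋢S
shortestAbsentSuffix-unique {x = x} {u = u} {S = S} (y ∷ p) xu⋢S u⊑S with occursIn? (p ++ x ∷ u) S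
... | yes pxu⊑S  = contradiction (occurs-trans (p ++ⁱ occurs-refl) pxu⊑S) xu⋢S
... | no _       = shortestAbsentSuffix-unique p xu⋢S u⊑S

-- Left-special suffixes as a potential

LeftSpecial : String σ → String σ → Set
LeftSpecial S u = ∃ λ x → ∃ λ y → x ≢ y × x ∷ u OccursIn S × y ∷ u OccursIn S

leftSpecial? : (S : String σ) → Decidable (LeftSpecial S)
leftSpecial? S u = Fin.any? λ x → Fin.any? λ y →
  ¬? (x Fin.≟ y) ×-dec occursIn? (x ∷ u) S ×-dec occursIn? (y ∷ u) S

φ : String σ → ℕ
φ S = length (filter (leftSpecial? S) (tails S))

Branching : String σ → Fin σ → String σ → Set
Branching S b u = LeftSpecial S u × ¬ (u ∷ʳ b OccursIn S)

branching? : (S : String σ) (b : Fin σ) → Decidable (Branching S b)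
branching? S b u = leftSpecial? S u ×-dec ¬? (occursIn? (u ∷ʳ b) S)

branchings : String σ → Fin σ → List (String σ)
branchings S b = filter (branching? S b) (tails S)

φ≤1+length : (S : String σ) → φ S ≤ suc (length S)
φ≤1+length S = subst (φ S ≤_) (length-tails S) (length-filter (leftSpecial? S) (tails S))

-- Prepending a letter keeps all suffixes and all occurrences; the only further suffix is the whole
-- word.
φ-∷ : (x : Fin σ) (S : String σ) → φ S ≤ φ (x ∷ S)
φ-∷ x S = ≤-trans
  (length-filter-mono (leftSpecial? S) (leftSpecial? (x ∷ S))
    (λ (y , z , y≢z , yu⊑S , zu⊑S) → y , z , y≢z , occurs-∷ yu⊑S , occurs-∷ zu⊑S) (tails S))
  tail≤
  where
  tail≤ : length (filter (leftSpecial? (x ∷ S)) (tails S)) ≤ φ (x ∷ S)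
  tail≤ with does (leftSpecial? (x ∷ S) (x ∷ S))
  ... | true  = n≤1+n _
  ... | false = ≤-refl

-- Two distinct words of equal length cannot both be suffixes of `S ∷ʳ b`, so one of `x ∷ u ∷ʳ b`
-- and `y ∷ u ∷ʳ b` lies in `S`, and `u ∷ʳ b` with it.
LeftSpecial-∷ʳ : LeftSpecial (S ∷ʳ b) (u ∷ʳ b) → LeftSpecial S u × u ∷ʳ b OccursIn S
LeftSpecial-∷ʳ {S = S} {b} {u} (x , y , x≢y , xub⊑ , yub⊑) =
  (x , y , x≢y , ∷ʳ-occurs-∷ʳ⁻ xub⊑ , ∷ʳ-occurs-∷ʳ⁻ yub⊑) , ub⊑S
  where
  ub⊑S : u ∷ʳ b OccursIn S
  ub⊑S with ∷ʳ-occurs-split xub⊑ | ∷ʳ-occurs-split yub⊑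
  ... | inj₁ xub⊑S    | _             = occurs-trans (occurs-∷ occurs-refl) xub⊑S
  ... | inj₂ _        | inj₁ yub⊑S    = occurs-trans (occurs-∷ occurs-refl) yub⊑S
  ... | inj₂ (p , eq) | inj₂ (q , eq′) =
    contradiction (∷ʳ-injectiveʳ p q (++-cancelʳ (u ∷ʳ b) _ _ (begin
      p ∷ʳ x ++ u ∷ʳ b  ≡⟨ ++-assoc p _ _ ⟩
      p ++ x ∷ u ∷ʳ b   ≡⟨ eq ⟨
      S ∷ʳ b            ≡⟨ eq′ ⟩
      q ++ y ∷ u ∷ʳ b   ≡⟨ ++-assoc q _ _ ⟨
      q ∷ʳ y ++ u ∷ʳ b  ∎))) x≢y
    where open ≡-Reasoning

-- Two disjoint families of left-special suffixes `u` of `S` are counted: `u ∷ʳ b` is absent from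
-- `S` in one and present in the other.
φ-∷ʳ : (S : String σ) (b : Fin σ) → length (branchings S b) + φ (S ∷ʳ b) ≤ suc (φ S)
φ-∷ʳ S b = begin
  length (branchings S b) + φ (S ∷ʳ b)
    ≤⟨ +-monoʳ-≤ (length (branchings S b)) φ-Sb ⟩
  length (branchings S b) + suc (length (filter (λ u → leftSpecial? (S ∷ʳ b) (u ∷ʳ b)) (tails S)))
    ≡⟨ +-suc (length (branchings S b)) _ ⟩
  suc (length (branchings S b) + length (filter (λ u → leftSpecial? (S ∷ʳ b) (u ∷ʳ b)) (tails S)))
    ≤⟨ s≤s (length-filter-disjoint (branching? S b) (λ u → leftSpecial? (S ∷ʳ b) (u ∷ʳ b))
         (leftSpecial? S) proj₁ (proj₁ ∘ LeftSpecial-∷ʳ)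
         (λ (_ , ub⋢S) ls → ub⋢S (proj₂ (LeftSpecial-∷ʳ ls))) (tails S)) ⟩
  suc (φ S) ∎
  where
  open ≤-Reasoning
  φ-Sb : φ (S ∷ʳ b) ≤ suc (length (filter (λ u → leftSpecial? (S ∷ʳ b) (u ∷ʳ b)) (tails S)))
  φ-Sb = begin
    length (filter LS? (tails (S ∷ʳ b)))
      ≡⟨ cong (length ∘ filter LS?) (tails-∷ʳ S b) ⟩
    length (filter LS? (map (_∷ʳ b) (tails S) ∷ʳ []))
      ≡⟨ cong length (filter-++ LS? (map (_∷ʳ b) (tails S)) ([] ∷ [])) ⟩
    length (filter LS? (map (_∷ʳ b) (tails S)) ++ filter LS? ([] ∷ []))
      ≡⟨ length-++ (filter LS? (map (_∷ʳ b) (tails S))) ⟩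
    length (filter LS? (map (_∷ʳ b) (tails S))) + length (filter LS? ([] ∷ []))
      -- The second summand stands for the empty suffix of `S ∷ʳ b`, which is not of the form
      -- `u ∷ʳ b`; it is bounded by 1.
      ≤⟨ +-mono-≤ (≤-reflexive (length-filter-map LS? (_∷ʳ b) (tails S))) (length-filter LS? ([] ∷ [])) ⟩
    length (filter (LS? ∘ (_∷ʳ b)) (tails S)) + 1
      ≡⟨ +-comm _ 1 ⟩
    suc (length (filter (LS? ∘ (_∷ʳ b)) (tails S))) ∎
    where LS? = leftSpecial? (S ∷ʳ b)

-- Changes of the MAWs when a letter is appended

-- A superset of the changes; only w₀ itself can be deleted.
changes : String σ → Fin σ → List (String σ)
changes S b = w₀ ∷ map (w₀ ∷ʳ_) (chars (S ∷ʳ b))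
              ++ cartesianProductWith (λ u x → x ∷ u ∷ʳ b) (branchings S b) (chars (S ∷ʳ b))
  where w₀ = shortestAbsentSuffix S (S ∷ʳ b)

length-cartesianProductWith : ∀ {a b c} {A : Set a} {B : Set b} {C : Set c} (f : A → B → C) xs ys →
  length (cartesianProductWith f xs ys) ≡ length xs * length ys
length-cartesianProductWith f []       ys = refl
length-cartesianProductWith f (x ∷ xs) ys = trans (length-++ (map (f x) ys))
  (cong₂ _+_ (length-map (f x) ys) (length-cartesianProductWith f xs ys))

length-changes : (S : String σ) (b : Fin σ) → length (changes S b) ≡
  suc (length (chars (S ∷ʳ b)) + length (branchings S b) * length (chars (S ∷ʳ b)))
length-changes S b = cong suc (trans (length-++ (map _ (chars (S ∷ʳ b))))
  (cong₂ _+_ (length-map _ (chars (S ∷ʳ b))) (length-cartesianProductWith _ (branchings S b) _)))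

-- A MAW of `S` is lost only by occurring in `S ∷ʳ b`, necessarily as a suffix. Its tail occurs in
-- `S`, so it is the shortest absent suffix.
deleted⇒changes : MAW S w → ¬ MAW (S ∷ʳ b) w → w ∈ changes S b
deleted⇒changes {w = []} (≢[] , _) _ = contradiction refl ≢[]
deleted⇒changes {S = S} {w = x ∷ u} {b} maw@(_ , w⋢S , sub) ¬maw
  with occursIn? (x ∷ u) (S ∷ʳ b)
... | no w⋢Sb  = contradiction ((λ ()) , w⋢Sb , λ v v⊏w → occurs-∷ʳ (sub v v⊏w)) ¬maw
... | yes w⊑Sb with ∷ʳ-occurs-split w⊑Sb
...   | inj₁ w⊑S      = contradiction w⊑S w⋢S
...   | inj₂ (p , eq) = here (begin
  x ∷ u                                  ≡⟨ shortestAbsentSuffix-unique p w⋢S (MAW-tail maw) ⟨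
  shortestAbsentSuffix S (p ++ x ∷ u)    ≡⟨ cong (shortestAbsentSuffix S) eq ⟨
  shortestAbsentSuffix S (S ∷ʳ b)        ∎)
  where open ≡-Reasoning

-- If `x ∷ u` and `u ∷ʳ y` both occurred in `S`, then `x ∷ u ∷ʳ y` would be a MAW of `S`. If `x ∷ u`
-- is absent, it is a suffix of `S ∷ʳ b` whose tail occurs in `S`, hence the shortest absent suffix.
-- Otherwise `u ∷ʳ y` is a suffix of `S ∷ʳ b`, so `y ≡ b` and `u` is a branching suffix of `S`.
added⇒changes : MAW (S ∷ʳ b) w → ¬ MAW S w → w ∈ changes S b
added⇒changes {w = []} (≢[] , _) _ = contradiction refl ≢[]
added⇒changes {S = S} {b} {w = x ∷ u′} maw@(_ , w⋢Sb , sub) ¬maw with initLast u′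
-- A single letter absent from `S ∷ʳ b` is already a MAW of `S`.
... | [] = contradiction ((λ ()) , w⋢Sb ∘ occurs-∷ʳ , absurd) ¬maw
  where
  absurd : ∀ v → ProperSubstring v (x ∷ []) → v OccursIn S
  absurd v (v⊑x , v≢x) with ∷ʳ-occurs-split {S = []} v⊑x
  ... | inj₁ v⊑[]          = occurs-trans v⊑[] []-occurs
  ... | inj₂ ([] , eq)     = contradiction (sym eq) v≢x
  ... | inj₂ (_ ∷ p , eq)  =
    subst (_OccursIn S) (sym (++-conicalʳ p v (sym (∷-injectiveʳ eq)))) []-occurs
... | u ∷ʳ′ y = w∈
  where
  w⋢S : ¬ (x ∷ u ∷ʳ y OccursIn S)
  w⋢S = w⋢Sb ∘ occurs-∷ʳ
  xu⊑Sb : x ∷ u OccursIn S ∷ʳ b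
  xu⊑Sb = MAW-init {w = x ∷ u} maw
  uy⊑Sb : u ∷ʳ y OccursIn S ∷ʳ b
  uy⊑Sb = MAW-tail maw
  u⊑S : u OccursIn S
  u⊑S = ∷ʳ-occurs-∷ʳ⁻ uy⊑Sb
  w₀ : String _
  w₀ = shortestAbsentSuffix S (S ∷ʳ b)
  x∈ : x ∈ chars (S ∷ʳ b)
  x∈ = ∈-deduplicate⁺ Fin._≟_ (occurs-∈ (here refl) xu⊑Sb)
  y∈ : y ∈ chars (S ∷ʳ b)
  y∈ = ∈-deduplicate⁺ Fin._≟_ (occurs-∈ (∈-++⁺ʳ u (here refl)) uy⊑Sb)

  branching : ∀ p → x ∷ u OccursIn S → S ≡ p ++ u → y ≡ b → Branching S b u
  branching p xu⊑S S≡pu refl with initLast p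
  -- `p` is nonempty, since `S ≡ p ++ u` contains the longer word `x ∷ u`. Its last letter `z`
  -- precedes the suffix `u`, and `x ≡ z` would make `x ∷ u ∷ʳ b` a suffix of `S ∷ʳ b`.
  ... | []       = contradiction (Infix.length-mono (subst (x ∷ u OccursIn_) S≡pu xu⊑S)) 1+n≰n
  ... | q ∷ʳ′ z  =
    (x , z , x≢z , xu⊑S , suffix-occurs q S≡qzu) ,
    λ ub⊑S → ¬maw (MAW-intro w⋢S xu⊑S ub⊑S)
    where
    S≡qzu : S ≡ q ++ z ∷ u
    S≡qzu = trans S≡pu (++-assoc q _ u)
    x≢z : x ≢ z
    x≢z refl = w⋢Sb (suffix-occurs q (trans (cong (_∷ʳ b) S≡qzu) (++-assoc q (z ∷ u) _)))

  w∈ : x ∷ u ∷ʳ y ∈ changes S b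
  w∈ with occursIn? (x ∷ u) S | ∷ʳ-occurs-split xu⊑Sb | ∷ʳ-occurs-split uy⊑Sb
  ... | no xu⋢S  | inj₁ xu⊑S     | _              = contradiction xu⊑S xu⋢S
  ... | no xu⋢S  | inj₂ (p , eq) | _              =
    there (∈-++⁺ˡ (subst (λ v → v ∷ʳ y ∈ map (w₀ ∷ʳ_) (chars (S ∷ʳ b)))
      (trans (cong (shortestAbsentSuffix S) eq) (shortestAbsentSuffix-unique p xu⋢S u⊑S))
      (∈-map⁺ (w₀ ∷ʳ_) y∈)))
  ... | yes xu⊑S | _             | inj₁ uy⊑S      =
    contradiction (MAW-intro w⋢S xu⊑S uy⊑S) ¬maw
  ... | yes xu⊑S | _             | inj₂ (p , eq)
    with S≡pu , b≡y ← ∷ʳ-suffix-init p eq =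
    there (∈-++⁺ʳ (map (w₀ ∷ʳ_) (chars (S ∷ʳ b)))
      (subst (λ c → x ∷ u ∷ʳ c ∈ cartesianProductWith (λ u x → x ∷ u ∷ʳ b) (branchings S b) (chars (S ∷ʳ b)))
        b≡y
        (∈-cartesianProductWith⁺ (λ u x → x ∷ u ∷ʳ b)
          (∈-filter⁺ (branching? S b) (subst (λ t → u ∈ tails t) (sym S≡pu) (∈-tails p))
            (branching p xu⊑S S≡pu (sym b≡y))) x∈)))

-- Reversal, and a single slide of the window

occurs-reverse : w OccursIn S → reverse w OccursIn reverse S
occurs-reverse {w = w} w⊑S with p , s , refl ← occurs-split w⊑S =
  subst (reverse w OccursIn_) (sym (begin
    reverse (p ++ w ++ s)                    ≡⟨ reverse-++ p (w ++ s) ⟩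
    reverse (w ++ s) ++ reverse p            ≡⟨ cong (_++ reverse p) (reverse-++ w s) ⟩
    (reverse s ++ reverse w) ++ reverse p    ≡⟨ ++-assoc (reverse s) (reverse w) (reverse p) ⟩
    reverse s ++ reverse w ++ reverse p      ∎))
    (occurs-++ (reverse s) (reverse w) (reverse p))
  where open ≡-Reasoning

occurs-reverse⁻ : reverse w OccursIn reverse S → w OccursIn S
occurs-reverse⁻ {w = w} {S = S} =
  subst₂ _OccursIn_ (reverse-involutive w) (reverse-involutive S) ∘ occurs-reverse

MAW-reverse : MAW S w → MAW (reverse S) (reverse w)
MAW-reverse {S = S} {w = w} (w≢[] , w⋢S , sub) =
  w≢[] ∘ reverse-injective {x = w} {y = []} ,
  w⋢S ∘ occurs-reverse⁻ ,
  λ v (v⊑w , v≢w) → subst (_OccursIn reverse S) (reverse-involutive v)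
    (occurs-reverse (sub (reverse v)
      ( subst (reverse v OccursIn_) (reverse-involutive w) (occurs-reverse v⊑w)
      , λ eq → v≢w (trans (sym (reverse-involutive v)) (cong reverse eq)))))

MAW-reverse⁻ : MAW (reverse S) (reverse w) → MAW S w
MAW-reverse⁻ {S = S} {w = w} =
  subst₂ MAW (reverse-involutive S) (reverse-involutive w) ∘ MAW-reverse

MAW-reverse-∷ : MAW (x ∷ S) w → MAW (reverse S ∷ʳ x) (reverse w)
MAW-reverse-∷ {x = x} {S = S} {w = w} maw =
  subst (λ R → MAW R (reverse w)) (unfold-reverse x S) (MAW-reverse maw)

MAW-reverse-∷⁻ : MAW (reverse S ∷ʳ x) (reverse w) → MAW (x ∷ S) w
MAW-reverse-∷⁻ {S = S} {x = x} {w = w} maw =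
  MAW-reverse⁻ (subst (λ R → MAW R (reverse w)) (sym (unfold-reverse x S)) maw)

-- Both windows are compared with their common part `S`. Membership in `MAW S` decides whether the
-- change comes from appending `b` or from removing `x`; the latter is read in reverse, as appending
-- `x` to `reverse S`.
slide-changes : (x : Fin σ) (S : String σ) (b : Fin σ) → (MAW (x ∷ S) △ MAW (S ∷ʳ b)) w →
                w ∈ changes S b ++ map reverse (changes (reverse S) x)
slide-changes {w = w} x S b w∈△ with MAW? S w | w∈△
... | yes maw  | inj₁ (_ , ¬new)    = ∈-++⁺ˡ (deleted⇒changes maw ¬new)
... | no ¬maw  | inj₂ (new , _)     = ∈-++⁺ˡ (added⇒changes new ¬maw)
... | no ¬maw  | inj₁ (old , _)     = ∈-++⁺ʳ (changes S b)
  (subst (_∈ map reverse (changes (reverse S) x)) (reverse-involutive w)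
    (∈-map⁺ reverse (added⇒changes (MAW-reverse-∷ old) (¬maw ∘ MAW-reverse⁻))))
... | yes maw  | inj₂ (_ , ¬old)    = ∈-++⁺ʳ (changes S b)
  (subst (_∈ map reverse (changes (reverse S) x)) (reverse-involutive w)
    (∈-map⁺ reverse (deleted⇒changes (MAW-reverse maw) (¬old ∘ MAW-reverse-∷⁻))))

card-slide : (x : Fin σ) (S : String σ) (b : Fin σ) →
  card (MAW-△-finite (x ∷ S) (S ∷ʳ b)) ≤ length (changes S b) + length (changes (reverse S) x)
card-slide x S b = begin
  card (MAW-△-finite (x ∷ S) (S ∷ʳ b))
    ≤⟨ length-⊆ unique (slide-changes x S b ∘ sound) ⟩
  length (changes S b ++ map reverse (changes (reverse S) x))
    ≡⟨ length-++ (changes S b) ⟩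
  length (changes S b) + length (map reverse (changes (reverse S) x))
    ≡⟨ cong (length (changes S b) +_) (length-map reverse (changes (reverse S) x)) ⟩
  length (changes S b) + length (changes (reverse S) x) ∎
  where
  open ≤-Reasoning
  open Finite (MAW-△-finite (x ∷ S) (S ∷ʳ b))

-- Amortized analysis for the upper bound

1≤σ : Fin σ → 1 ≤ σ
1≤σ {suc σ} _ = s≤s z≤n

length-∷ʳ : (S : String σ) (b : Fin σ) → length (S ∷ʳ b) ≡ suc (length S)
length-∷ʳ S b = trans (length-++ S) (+-comm (length S) 1)

-- The 3 collects the shortest absent suffix, its one-letter extensions, and the 1 in `φ-∷ʳ`, each
-- costing at most `m`. The potential pays for the branching suffixes.
length-changes-≤ : (S : String σ) (b : Fin σ) →
  length (changes S b) + (suc (length S) ⊓ σ) * φ (S ∷ʳ b) ≤ (suc (length S) ⊓ σ) * (3 + φ S)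
length-changes-≤ {σ} S b = begin
  length (changes S b) + m * φ (S ∷ʳ b)      ≡⟨ cong (_+ m * φ (S ∷ʳ b)) (length-changes S b) ⟩
  1 + (ℓ + k * ℓ) + m * φ (S ∷ʳ b)
    ≤⟨ +-monoˡ-≤ (m * φ (S ∷ʳ b)) (+-mono-≤ 1≤m (+-mono-≤ ℓ≤m (*-monoʳ-≤ k ℓ≤m))) ⟩
  m + (m + k * m) + m * φ (S ∷ʳ b)           ≡⟨ regroup m k (φ (S ∷ʳ b)) ⟩
  m * (2 + (k + φ (S ∷ʳ b)))                 ≤⟨ *-monoʳ-≤ m (+-monoʳ-≤ 2 (φ-∷ʳ S b)) ⟩
  m * (3 + φ S)                              ∎
  where
  open ≤-Reasoning
  m = suc (length S) ⊓ σ
  ℓ = length (chars (S ∷ʳ b))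
  k = length (branchings S b)
  1≤m : 1 ≤ m
  1≤m = ⊓-glb (s≤s z≤n) (1≤σ b)
  ℓ≤m : ℓ ≤ m
  ℓ≤m = subst (λ t → ℓ ≤ t ⊓ σ) (length-∷ʳ S b) (length-chars (S ∷ʳ b))
  regroup : ∀ m k p → m + (m + k * m) + m * p ≡ m * (2 + (k + p))
  regroup = solve-∀

-- Appending `b` is paid by the potential of the old window. Removing `x` is an append in reversed
-- time, so it is paid by the potential of the reversed new window. Each half costs a further
-- `3 * m`.
card-slide-≤ : (x : Fin σ) (S : String σ) (b : Fin σ) → let m = suc (length S) ⊓ σ in
  card (MAW-△-finite (x ∷ S) (S ∷ʳ b)) + (m * φ (S ∷ʳ b) + m * φ (reverse (x ∷ S))) ≤
  6 * m + (m * φ (x ∷ S) + m * φ (reverse (S ∷ʳ b)))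
card-slide-≤ {σ} x S b = begin
  card (MAW-△-finite (x ∷ S) (S ∷ʳ b)) + (m * φ (S ∷ʳ b) + m * φ (reverse (x ∷ S)))
    ≤⟨ +-monoˡ-≤ _ (card-slide x S b) ⟩
  (ℓ + ℓ′) + (m * φ (S ∷ʳ b) + m * φ (reverse (x ∷ S)))
    ≡⟨ interchange ℓ ℓ′ (m * φ (S ∷ʳ b)) (m * φ (reverse (x ∷ S))) ⟩
  (ℓ + m * φ (S ∷ʳ b)) + (ℓ′ + m * φ (reverse (x ∷ S)))
    ≤⟨ +-mono-≤ (length-changes-≤ S b) left ⟩
  m * (3 + φ S) + m * (3 + φ (reverse S))
    ≤⟨ +-mono-≤ (*-monoʳ-≤ m (+-monoʳ-≤ 3 (φ-∷ x S))) (*-monoʳ-≤ m (+-monoʳ-≤ 3 right)) ⟩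
  m * (3 + φ (x ∷ S)) + m * (3 + φ (reverse (S ∷ʳ b)))
    ≡⟨ regroup m (φ (x ∷ S)) (φ (reverse (S ∷ʳ b))) ⟩
  6 * m + (m * φ (x ∷ S) + m * φ (reverse (S ∷ʳ b))) ∎
  where
  open ≤-Reasoning
  m = suc (length S) ⊓ σ
  ℓ = length (changes S b)
  ℓ′ = length (changes (reverse S) x)
  interchange : ∀ p q r s → (p + q) + (r + s) ≡ (p + r) + (q + s)
  interchange = solve-∀
  regroup : ∀ m p q → m * (3 + p) + m * (3 + q) ≡ 6 * m + (m * p + m * q)
  regroup = solve-∀
  left : ℓ′ + m * φ (reverse (x ∷ S)) ≤ m * (3 + φ (reverse S))
  left = subst₂ (λ R t → ℓ′ + (suc t ⊓ σ) * φ R ≤ (suc t ⊓ σ) * (3 + φ (reverse S)))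
    (sym (unfold-reverse x S)) (length-reverse S) (length-changes-≤ (reverse S) x)
  right : φ (reverse S) ≤ φ (reverse (S ∷ʳ b))
  right = subst (λ R → φ (reverse S) ≤ φ R) (sym (reverse-++ S (b ∷ []))) (φ-∷ b (reverse S))

take-∷ʳ : ∀ d (L : String σ) → d < length L → ∃ λ b → take (suc d) L ≡ take d L ∷ʳ b
take-∷ʳ zero    (b ∷ L) _       = b , refl
take-∷ʳ (suc d) (x ∷ L) (s≤s d<) = map₂ (cong (x ∷_)) (take-∷ʳ d L d<)

slide : ∀ d i (L : String σ) → i + suc d < length L → ∃ λ x → ∃ λ S → ∃ λ b →
  take (suc d) (drop i L) ≡ x ∷ S × take (suc d) (drop (suc i) L) ≡ S ∷ʳ b × length S ≡ d
slide d zero    (x ∷ L) (s≤s d<) with b , eq ← take-∷ʳ d L d< =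
  x , take d L , b , refl , eq , trans (length-take d L) (m≤n⇒m⊓n≡m (<⇒≤ d<))
slide d (suc i) (_ ∷ L) (s≤s i+d<) = slide d i L i+d<

sum-upTo-suc : ∀ (f : ℕ → ℕ) N → sum (map f (upTo (suc N))) ≡ sum (map f (upTo N)) + f N
sum-upTo-suc f N = begin
  sum (map f (upTo (suc N)))           ≡⟨ cong (sum ∘ map f) (upTo-∷ʳ N) ⟨
  sum (map f (upTo N ∷ʳ N))            ≡⟨ cong sum (map-++ f (upTo N) (N ∷ [])) ⟩
  sum (map f (upTo N) ∷ʳ f N)          ≡⟨ sum-++ (map f (upTo N)) (f N ∷ []) ⟩
  sum (map f (upTo N)) + (f N + 0)     ≡⟨ cong (sum (map f (upTo N)) +_) (+-identityʳ (f N)) ⟩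
  sum (map f (upTo N)) + f N           ∎
  where open ≡-Reasoning

module _ (f X Y : ℕ → ℕ) (C : ℕ) where

  sum-amortized : ∀ N → (∀ i → i < N → f i + (X (suc i) + Y i) ≤ C + (X i + Y (suc i))) →
                  sum (map f (upTo N)) + (X N + Y 0) ≤ N * C + (X 0 + Y N)
  sum-amortized zero    _    = ≤-refl
  -- The intermediate potentials are added to both sides and cancelled, so that no subtraction of
  -- naturals occurs.
  sum-amortized (suc N) step = +-cancelʳ-≤ (X N + Y N) _ _ (begin
    sum (map f (upTo (suc N))) + (X (suc N) + Y 0) + (X N + Y N)
      ≡⟨ cong (λ s → s + (X (suc N) + Y 0) + (X N + Y N)) (sum-upTo-suc f N) ⟩
    (sum (map f (upTo N)) + f N) + (X (suc N) + Y 0) + (X N + Y N)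
      ≡⟨ regroup₁ (sum (map f (upTo N))) (f N) (X (suc N)) (Y 0) (X N) (Y N) ⟩
    (sum (map f (upTo N)) + (X N + Y 0)) + (f N + (X (suc N) + Y N))
      ≤⟨ +-mono-≤ (sum-amortized N (λ i i<N → step i (m≤n⇒m≤1+n i<N))) (step N ≤-refl) ⟩
    (N * C + (X 0 + Y N)) + (C + (X N + Y (suc N)))
      ≡⟨ regroup₂ (N * C) (X 0) (Y N) C (X N) (Y (suc N)) ⟩
    (suc N * C + (X 0 + Y (suc N))) + (X N + Y N) ∎)
    where
    open ≤-Reasoning
    regroup₁ : ∀ s f x′ y₀ x y → (s + f) + (x′ + y₀) + (x + y) ≡ (s + (x + y₀)) + (f + (x′ + y))
    regroup₁ = solve-∀
    regroup₂ : ∀ s x₀ y c x y′ → (s + (x₀ + y)) + (c + (x + y′)) ≡ (c + s + (x₀ + y′)) + (x + y)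
    regroup₂ = solve-∀

𝒮-upper : ∀ d n → 1 ≤ d → d < n → (T : Vec (Fin σ) n) → 𝒮 T d ≤ 6 * ((d ⊓ σ) * n)
𝒮-upper {σ} (suc d) n _ d<n T = begin
  𝒮 T (suc d)
    ≤⟨ m≤m+n _ _ ⟩
  𝒮 T (suc d) + (m * φ (W N) + m * φ (reverse (W 0)))
    ≤⟨ sum-amortized f (λ i → m * φ (W i)) (λ i → m * φ (reverse (W i))) (6 * m) N step ⟩
  N * (6 * m) + (m * φ (W 0) + m * φ (reverse (W N)))
    ≤⟨ +-monoʳ-≤ (N * (6 * m))
         (+-mono-≤ (*-monoʳ-≤ m φ-first) (*-monoʳ-≤ m φ-last)) ⟩
  N * (6 * m) + (m * (2 + d) + m * (2 + d))
    -- The window length is `suc d`. The boundary potentials `2 * (2 + d)` fit into `6 * suc d` with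
    -- `2 + 4 * d` to spare, and `N + suc d` is `n`.
    ≤⟨ m≤m+n _ (m * (2 + 4 * d)) ⟩
  N * (6 * m) + (m * (2 + d) + m * (2 + d)) + m * (2 + 4 * d)
    ≡⟨ regroup N m d ⟩
  6 * (m * (N + suc d))
    ≡⟨ cong (λ t → 6 * (m * t)) (m∸n+n≡m (<⇒≤ d<n)) ⟩
  6 * (m * n) ∎
  where
  open ≤-Reasoning
  m = suc d ⊓ σ
  N = n ∸ suc d
  W : ℕ → String σ
  W = window T (suc d)
  f : ℕ → ℕ
  f i = card (MAW-△-finite (W i) (W (suc i)))
  length-window : ∀ i → length (W i) ≤ suc d
  length-window i = ≤-trans (≤-reflexive (length-take (suc d) (drop i (toList T)))) (m⊓n≤m _ _)
  φ-first : φ (W 0) ≤ 2 + d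
  φ-first = ≤-trans (φ≤1+length (W 0)) (s≤s (length-window 0))
  φ-last : φ (reverse (W N)) ≤ 2 + d
  φ-last = ≤-trans (φ≤1+length (reverse (W N)))
    (s≤s (≤-trans (≤-reflexive (length-reverse (W N))) (length-window N)))
  regroup : ∀ N m d → N * (6 * m) + (m * (2 + d) + m * (2 + d)) + m * (2 + 4 * d) ≡ 6 * (m * (N + suc d))
  regroup = solve-∀
  step : ∀ i → i < N → f i + (m * φ (W (suc i)) + m * φ (reverse (W i))) ≤
                        6 * m + (m * φ (W i) + m * φ (reverse (W (suc i))))
  step i i<N with slide d i (toList T) (subst (i + suc d <_) (sym (length-toList T))
                    (subst (i + suc d <_) (m∸n+n≡m (<⇒≤ d<n)) (+-monoˡ-< (suc d) i<N)))
  ... | x , S , b , eq , eq′ , refl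
    rewrite eq | eq′ = card-slide-≤ x S b

-- Lower bound on the number of changes

card-≥ : ∀ {a p} {A : Set a} {P : Pred A p} (F : Finite P) {ys : List A} →
         Unique ys → (∀ {y} → y ∈ ys → P y) → length ys ≤ card F
card-≥ F uniq ys⊆P = length-⊆ uniq (Finite.complete F ∘ ys⊆P)

-- Factors of an infinite word

factorVec : (ℕ → Fin σ) → ℕ → (l : ℕ) → Vec (Fin σ) l
factorVec f a zero    = []
factorVec f a (suc l) = f a ∷ factorVec f (suc a) l

factor : (ℕ → Fin σ) → ℕ → ℕ → String σ
factor f a l = toList (factorVec f a l)

module _ (f : ℕ → Fin σ) where

  length-factor : ∀ a l → length (factor f a l) ≡ l
  length-factor a zero    = refl
  length-factor a (suc l) = cong suc (length-factor (suc a) l)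

  factor-++ : ∀ a l m → factor f a (l + m) ≡ factor f a l ++ factor f (a + l) m
  factor-++ a zero    m = cong (λ b → factor f b m) (sym (+-identityʳ a))
  factor-++ a (suc l) m = cong (f a ∷_) (trans (factor-++ (suc a) l m)
    (cong (λ b → factor f (suc a) l ++ factor f b m) (sym (+-suc a l))))

  factor-∷ʳ : ∀ a l → factor f a (suc l) ≡ factor f a l ∷ʳ f (a + l)
  factor-∷ʳ a l = trans (cong (factor f a) (+-comm 1 l)) (factor-++ a l 1)

  take-drop-factor : ∀ a i l n → i + l ≤ n → take l (drop i (factor f a n)) ≡ factor f (a + i) l
  take-drop-factor a zero    zero    n       _           = refl
  take-drop-factor a zero    (suc l) (suc n) (s≤s l≤n)   rewrite +-identityʳ a =
    cong (f a ∷_) (trans (take-drop-factor (suc a) 0 l n l≤n)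
      (cong (λ b → factor f b l) (+-identityʳ (suc a))))
  take-drop-factor a (suc i) l       (suc n) (s≤s i+l≤n) =
    trans (take-drop-factor (suc a) i l n i+l≤n) (cong (λ b → factor f b l) (sym (+-suc a i)))

  ∈-factor⁻ : ∀ a l {x} → x ∈ factor f a l → ∃ λ b → a ≤ b × b < a + l × x ≡ f b
  ∈-factor⁻ a (suc l) (here x≡)  = a , ≤-refl , m<m+n a (s≤s z≤n) , x≡
  ∈-factor⁻ a (suc l) (there x∈) with b , a<b , b< , x≡ ← ∈-factor⁻ (suc a) l x∈ =
    b , <⇒≤ a<b , <-≤-trans b< (≤-reflexive (sym (+-suc a l))) , x≡

  factor-occurs : ∀ {a b l n} → a ≤ b → b + l ≤ a + n → factor f b l OccursIn factor f a n
  factor-occurs {a} {b} {l} {n} a≤b b+l≤ with i , refl ← m≤n⇒∃[o]m+o≡n a≤b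
    with r , refl ← m≤n⇒∃[o]m+o≡n (+-cancelˡ-≤ a _ _ (subst (_≤ a + n) (+-assoc a i l) b+l≤)) =
    subst (factor f (a + i) l OccursIn_) (sym (begin
      factor f a (i + l + r)    ≡⟨ cong (factor f a) (+-assoc i l r) ⟩
      factor f a (i + (l + r))  ≡⟨ factor-++ a i (l + r) ⟩
      factor f a i ++ factor f (a + i) (l + r)
        ≡⟨ cong (factor f a i ++_) (factor-++ (a + i) l r) ⟩
      factor f a i ++ factor f (a + i) l ++ factor f (a + i + l) r ∎))
      (occurs-++ (factor f a i) _ _)
    where open ≡-Reasoning

  occurs-factor⁻ : ∀ {a n} → w OccursIn factor f a n →
    ∃ λ b → a ≤ b × b + length w ≤ a + n × w ≡ factor f b (length w)
  occurs-factor⁻ {w = w} {a} {n} w⊑ with p , s , eq ← occurs-split w⊑ =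
    a + length p , m≤m+n a _ ,
    ≤-trans (≤-reflexive (+-assoc a (length p) (length w))) (+-monoʳ-≤ a in-range) ,
    (begin
      w                                                        ≡⟨ take-++ w s ⟨
      take (length w) (w ++ s)                                 ≡⟨ cong (take (length w)) (drop-++ p (w ++ s)) ⟨
      take (length w) (drop (length p) (p ++ w ++ s))          ≡⟨ cong (take (length w) ∘ drop (length p)) eq ⟨
      take (length w) (drop (length p) (factor f a n))
        ≡⟨ take-drop-factor a (length p) (length w) n in-range ⟩
      factor f (a + length p) (length w)                       ∎)
    where
    open ≡-Reasoning
    take-++ : ∀ (xs ys : String σ) → take (length xs) (xs ++ ys) ≡ xs
    take-++ []       ys = refl
    take-++ (x ∷ xs) ys = cong (x ∷_) (take-++ xs ys)
    drop-++ : ∀ (xs ys : String σ) → drop (length xs) (xs ++ ys) ≡ ys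
    drop-++ []       ys = refl
    drop-++ (x ∷ xs) ys = drop-++ xs ys
    in-range : length p + length w ≤ n
    in-range = ≤-trans (m≤m+n _ (length s)) (≤-reflexive (begin
      length p + length w + length s     ≡⟨ +-assoc (length p) _ _ ⟩
      length p + (length w + length s)   ≡⟨ cong (length p +_) (length-++ w) ⟨
      length p + length (w ++ s)         ≡⟨ length-++ p ⟨
      length (p ++ w ++ s)               ≡⟨ cong length eq ⟨
      length (factor f a n)              ≡⟨ length-factor a n ⟩
      n                                  ∎))

  -- Only the two end letters of an occurrence are retained; they suffice to refute occurrences of
  -- the marker words below.
  ends-occur-factor⁻ : ∀ {a n l x y} (u : String σ) → length u ≡ l → x ∷ u ∷ʳ y OccursIn factor f a n →
    ∃ λ b → a ≤ b × b + suc l < a + n × x ≡ f b × y ≡ f (b + suc l)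
  ends-occur-factor⁻ {x = x} {y} u refl w⊑
    with b , a≤b , b+l≤ , eq ← occurs-factor⁻ w⊑
    rewrite length-∷ʳ u y =
    b , a≤b ,
    ≤-trans (≤-reflexive (sym (+-suc b _))) b+l≤ ,
    ∷-injectiveˡ eq ,
    ∷ʳ-injectiveʳ (x ∷ u) (factor f b (suc (length u))) (trans eq (factor-∷ʳ b (suc (length u))))

-- Sums with large terms at regular distances

sum-upTo-mono : ∀ (f : ℕ → ℕ) {M N} → M ≤ N → sum (map f (upTo M)) ≤ sum (map f (upTo N))
sum-upTo-mono f {M} M≤N = go (≤⇒≤′ M≤N)
  where
  go : ∀ {N} → M ≤′ N → sum (map f (upTo M)) ≤ sum (map f (upTo N))
  go ≤′-refl            = ≤-refl
  go (≤′-step {N} M≤′N) = ≤-trans (go M≤′N)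
    (≤-trans (m≤m+n _ (f N)) (≤-reflexive (sym (sum-upTo-suc f N))))

module _ (f : ℕ → ℕ) (g q N : ℕ) (large : ∀ t → t * g < N → q * g ≤ f (t * g)) where

  -- The first step of each block of `g` steps pays `q` for every step of the block, so a truncated
  -- last block is covered as well.
  sum-periodic-lower-bound : ∀ t M → M ≤ N → M ≤ t * g → M * q ≤ sum (map f (upTo M))
  sum-periodic-lower-bound zero    zero _   _     = z≤n
  sum-periodic-lower-bound (suc t) M    M≤N M≤1+tg with M ≤? t * g
  ... | yes M≤tg = sum-periodic-lower-bound t M M≤N M≤tg
  ... | no  M≰tg = begin
    M * q                                    ≤⟨ *-monoˡ-≤ q M≤1+tg ⟩
    (g + t * g) * q                          ≡⟨ regroup g (t * g) q ⟩
    t * g * q + q * g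
      ≤⟨ +-mono-≤ (sum-periodic-lower-bound t (t * g) (<⇒≤ tg<N) ≤-refl) (large t tg<N) ⟩
    sum (map f (upTo (t * g))) + f (t * g)   ≡⟨ sum-upTo-suc f (t * g) ⟨
    sum (map f (upTo (suc (t * g))))         ≤⟨ sum-upTo-mono f (≰⇒> M≰tg) ⟩
    sum (map f (upTo M))                     ∎
    where
    open ≤-Reasoning
    tg<N : t * g < N
    tg<N = <-≤-trans (≰⇒> M≰tg) M≤N
    regroup : ∀ g t q → (g + t) * q ≡ t * q + q * g
    regroup = solve-∀

module _ (f : ℕ → Fin σ) where

  window-factor : ∀ a {n d i} → i + d ≤ n → window (factorVec f a n) d i ≡ factor f (a + i) d
  window-factor a {n} {d} {i} i+d≤n = take-drop-factor f a i d n i+d≤n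

  slideCard : ℕ → ℕ → ℕ
  slideCard d a = card (MAW-△-finite (factor f a d) (factor f (suc a) d))

  𝒮-lower : ∀ a k q {n d} → d ≤ n → (∀ t → q * suc k ≤ slideCard d (a + t * suc k)) →
            (n ∸ d) * q ≤ 𝒮 (factorVec f a n) d
  𝒮-lower a k q {n} {d} d≤n large =
    -- `n ∸ d` blocks suffice, as each has length at least 1.
    sum-periodic-lower-bound _ (suc k) q (n ∸ d) large′ (n ∸ d) (n ∸ d) ≤-refl (m≤m*n (n ∸ d) (suc k))
    where
    T = factorVec f a n
    large′ : ∀ t → t * suc k < n ∸ d →
      q * suc k ≤ card (MAW-△-finite (window T d (t * suc k)) (window T d (suc (t * suc k))))
    large′ t t<
      with i+d<n ← subst (t * suc k + d <_) (m∸n+n≡m d≤n) (+-monoˡ-< d t<)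
      rewrite window-factor a {n} {d} {t * suc k} (<⇒≤ i+d<n)
            | window-factor a {n} {d} {suc (t * suc k)} i+d<n
            | +-suc a (t * suc k) = large t

-- The alternating word

alternating : ℕ → Fin (2 + σ)
alternating zero          = zero
alternating (suc zero)    = suc zero
alternating (suc (suc i)) = alternating i

alternating-≢ : ∀ i → alternating {σ} i ≢ alternating (suc i)
alternating-≢ zero          ()
alternating-≢ (suc zero)    ()
alternating-≢ (suc (suc i)) = alternating-≢ i

factor-alternating : ∀ a l → factor (alternating {σ}) (2 + a) l ≡ factor alternating a l
factor-alternating a zero    = refl
factor-alternating a (suc l) = cong (alternating a ∷_) (factor-alternating (suc a) l)

-- The new window is itself a MAW of the old one: it has the same length but another first letter,
-- while its proper substrings occur in the old window. It stops being a MAW once it is the window.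
alternating-change : ∀ a d → let f = alternating {σ} in
  (MAW (factor f a (suc d)) △ MAW (factor f (suc a) (suc d))) (factor f (suc a) (suc d))
alternating-change {σ} a d = inj₁ (((λ ()) , W′⋢W , sub) , λ (_ , W′⋢W′ , _) → W′⋢W′ occurs-refl)
  where
  f = alternating {σ}
  W = factor f a (suc d)
  W′ = factor f (suc a) (suc d)
  W′⋢W : ¬ (W′ OccursIn W)
  W′⋢W W′⊑W with b , a≤b , b+l≤ , eq ← occurs-factor⁻ f {n = suc d} W′⊑W
    rewrite length-factor f (suc (suc a)) d
    with refl ← ≤-antisym a≤b (+-cancelʳ-≤ (suc d) b a b+l≤) =
    alternating-≢ a (sym (∷-injectiveˡ eq))
  sub : ∀ v → ProperSubstring v W′ → v OccursIn W
  sub v (v⊑W′ , v≢W′) with occurs-factor⁻ f {n = suc d} v⊑W′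
  ... | suc b , s≤s a≤b , b+l≤ , eq with a ≟ b
  ...   | yes refl = subst (_OccursIn W) (sym eq) (factor-occurs f {n = suc d} (n≤1+n a)
    (≤-trans (≤-reflexive (sym (+-suc a (length v)))) (+-monoʳ-≤ a (≤∧≢⇒< (+-cancelˡ-≤ (suc a) _ _ b+l≤)
      λ l≡ → v≢W′ (trans eq (cong (factor f (suc a)) l≡))))))
  -- The factor starts at `2 + b′` with `a ≤ b′`; by periodicity it also occurs two positions
  -- earlier.
  ...   | no a≢b with s≤s {n = b′} a≤b′ ← ≤∧≢⇒< a≤b a≢b =
    subst (_OccursIn W) (trans (sym (factor-alternating b′ (length v))) (sym eq))
      (factor-occurs f {n = suc d} a≤b′ (<⇒≤ (s≤s⁻¹ b+l≤)))

alternating-slideCard : ∀ d a → 1 ≤ slideCard (alternating {σ}) (suc d) a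
alternating-slideCard d a = card-≥ (MAW-△-finite _ _) ([] ∷ [])
  λ { (here refl) → alternating-change a d }

-- Markers at the multiples of 1 + k, numbered cyclically modulo p, and zero elsewhere

module Marked {σ p} .{{_ : NonZero p}} (p≤σ : p ≤ σ) (k : ℕ) where

  private
    g : ℕ
    g = suc k

  -- The `suc` separates the markers from the filler `zero`.
  marker : ℕ → Fin (suc σ)
  marker s = suc (inject≤ (s mod p) p≤σ)

  -- Equal markers have numbers with equal residues modulo `p`; if the quotients differ, the numbers
  -- are at least `p` apart.
  marker-injective : ∀ {s t} → s ≤ t → t < s + p → marker s ≡ marker t → s ≡ t
  marker-injective {s} {t} s≤t t<s+p eq = ≤-antisym s≤t (≮⇒≥ λ s<t → <⇒≱ t<s+p (begin
    s + p                       ≡⟨ cong (_+ p) (m≡m%n+[m/n]*n s p) ⟩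
    s % p + s / p * p + p       ≡⟨ +-assoc (s % p) (s / p * p) p ⟩
    s % p + (s / p * p + p)     ≡⟨ cong₂ _+_ %≡ (+-comm (s / p * p) p) ⟩
    t % p + (p + s / p * p)     ≤⟨ +-monoʳ-≤ (t % p) (*-monoˡ-≤ p (≤∧≢⇒< (/-monoˡ-≤ p s≤t) (/≢ s<t))) ⟩
    t % p + t / p * p           ≡⟨ m≡m%n+[m/n]*n t p ⟨
    t                           ∎))
    where
    open ≤-Reasoning
    %≡ : s % p ≡ t % p
    %≡ = trans (sym (Fin.toℕ-fromℕ< _)) (trans
      (cong toℕ (Fin.inject≤-injective p≤σ p≤σ _ _ (Fin.suc-injective eq)))
      (Fin.toℕ-fromℕ< _))
    /≢ : s < t → s / p ≢ t / p
    /≢ s<t /≡ = <⇒≢ s<t (trans (m≡m%n+[m/n]*n s p)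
      (trans (cong₂ (λ r a → r + a * p) %≡ /≡) (sym (m≡m%n+[m/n]*n t p))))

  letter : ℕ → ℕ → Fin (suc σ)
  letter zero    s = marker s
  letter (suc _) _ = zero

  marked : ℕ → Fin (suc σ)
  marked t = letter (t % g) (t / g)

  marked-marker : ∀ s → marked (s * g) ≡ marker s
  marked-marker s = cong₂ letter (m*n%n≡0 s g) (m*n/n≡m s g)

  marked-filler : ∀ j s → suc j < g → marked (suc j + s * g) ≡ zero
  marked-filler j s j<g = cong (λ r → letter r ((suc j + s * g) / g))
    (trans ([m+kn]%n≡m%n (suc j) s g) (m<n⇒m%n≡m j<g))

  marked-marker⁻ : ∀ t {s} → marked t ≡ marker s → ∃ λ r → t ≡ r * g × marker r ≡ marker s
  marked-marker⁻ t eq with t % g | m≡m%n+[m/n]*n t g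
  ... | zero | t≡ = t / g , t≡ , eq

  factor-filler : ∀ j l s → l + j < g → factor marked (suc l + s * g) j ≡ replicate j zero
  factor-filler zero    l s _    = refl
  factor-filler (suc j) l s l+j< = cong₂ _∷_
    (marked-filler l s (≤-trans (s≤s (m≤m+n (suc l) j)) (subst (_< g) (+-suc l j) l+j<)))
    (factor-filler j (suc l) s (subst (_< g) (+-suc l j) l+j<))

  factor-marker-filler : ∀ j s → j < g → factor marked (s * g) (suc j) ≡ marker s ∷ replicate j zero
  factor-marker-filler j s j<g = cong₂ _∷_ (marked-marker s) (factor-filler j 0 s j<g)

  factor-filler-marker : ∀ j l s → l + j ≡ k →
    factor marked (suc l + s * g) (suc j) ≡ replicate j zero ∷ʳ marker (suc s)
  factor-filler-marker j l s refl = trans (factor-∷ʳ marked (suc l + s * g) j)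
    (cong₂ _∷ʳ_ (factor-filler j l s ≤-refl)
      (trans (cong marked (regroup l (s * g) j)) (marked-marker (suc s))))
    where
    regroup : ∀ l t j → suc l + t + j ≡ suc (l + j) + t
    regroup = solve-∀

  -- Marker number 1 + c + q is the letter entering the window at this step; the markers
  -- c , … , c + q lie in the window.
  module Entering (c q d a : ℕ) (q<p : q < p) (d<pg : d < p * g) (qg<d : suc q * g < d)
                  (end : a + d ≡ suc (c + q) * g) where

    e : ℕ
    e = suc (c + q)

    candidate : ℕ → ℕ → String (suc σ)
    candidate i j = marker (c + i) ∷ replicate j zero ∷ʳ marker e

    marker-cancel : ∀ {i i′} → i ≤ q → i′ ≤ q → marker (c + i) ≡ marker (c + i′) → i ≡ i′
    marker-cancel {i} {i′} i≤q i′≤q eq = +-cancelˡ-≡ c i i′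
      ([ (λ i≤i′ → marker-injective (+-monoʳ-≤ c i≤i′) (close i i′≤q) eq)
       , (λ i′≤i → sym (marker-injective (+-monoʳ-≤ c i′≤i) (close i′ i≤q) (sym eq))) ]′ (≤-total i i′))
      where
      close : ∀ s {t} → t ≤ q → c + t < c + s + p
      close s {t} t≤q = subst (c + t <_) (sym (+-assoc c s p))
        (+-monoʳ-< c (≤-trans (s≤s t≤q) (≤-trans q<p (m≤n+m p s))))

    -- The previous copy of marker `e` lies `p * g` positions earlier, which is more than the window
    -- length `d`.
    new-marker : ∀ t → a ≤ t → t < a + d → marked t ≢ marker e
    new-marker t a≤t t<a+d eq with s , refl , s≡e ← marked-marker⁻ t eq =
      <⇒≢ s<e (marker-injective (<⇒≤ s<e) e<s+p s≡e)
      where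
      s<e : s < e
      s<e = *-cancelʳ-< g s e (<-≤-trans t<a+d (≤-reflexive end))
      e<s+p : e < s + p
      e<s+p = *-cancelʳ-< g e (s + p) (begin-strict
        e * g           ≡⟨ end ⟨
        a + d           <⟨ +-mono-≤-< a≤t d<pg ⟩
        s * g + p * g   ≡⟨ *-distribʳ-+ g s p ⟨
        (s + p) * g     ∎)
        where open ≤-Reasoning

    -- The old window lacks marker `e`, hence the tail of the candidate. In the new window marker
    -- `e` occurs only at the end, where it is preceded by `k` zeros and marker `c + q`; since
    -- `i < q`, the candidate is absent.
    change : ∀ {i j} → i < q → j < g →
      (MAW (factor marked a d) △ MAW (factor marked (suc a) d)) (candidate i j)
    change {i} {j} i<q j<g = inj₂ (MAW-intro absent init⊑ tail⊑ , not-old)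
      where
      not-old : ¬ MAW (factor marked a d) (candidate i j)
      not-old maw
        with t , a≤t , t<a+d , eq ←
               ∈-factor⁻ marked a d (occurs-∈ (∈-++⁺ʳ (replicate j zero) (here refl)) (MAW-tail maw)) =
        new-marker t a≤t t<a+d (sym eq)

      -- Marker `c`, and so each of the markers up to `c + q`, still lies in the window after the
      -- slide.
      a<cg : a < c * g
      a<cg = +-cancelʳ-< d a (c * g) (begin-strict
        a + d                 ≡⟨ end ⟩
        suc (c + q) * g       ≡⟨ cong (_* g) (+-suc c q) ⟨
        (c + suc q) * g       ≡⟨ *-distribʳ-+ g c (suc q) ⟩
        c * g + suc q * g     <⟨ +-monoʳ-< (c * g) qg<d ⟩
        c * g + d             ∎)
        where open ≤-Reasoning

      init⊑ : marker (c + i) ∷ replicate j zero OccursIn factor marked (suc a) d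
      init⊑ = subst (_OccursIn factor marked (suc a) d) (factor-marker-filler j (c + i) j<g)
        (factor-occurs marked (≤-trans a<cg (*-monoˡ-≤ g (m≤m+n c i))) (begin
          (c + i) * g + suc j   ≤⟨ +-monoʳ-≤ ((c + i) * g) j<g ⟩
          (c + i) * g + g       ≡⟨ +-comm ((c + i) * g) g ⟩
          suc (c + i) * g       ≤⟨ *-monoˡ-≤ g (s≤s (+-monoʳ-≤ c (<⇒≤ i<q))) ⟩
          e * g                 ≡⟨ end ⟨
          a + d                 ≤⟨ n≤1+n (a + d) ⟩
          suc a + d             ∎))
        where open ≤-Reasoning

      tail⊑ : replicate j zero ∷ʳ marker e OccursIn factor marked (suc a) d
      -- The first `l = k - j` zeros after marker `c + q` are skipped, leaving exactly `j` before
      -- marker `e`.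
      tail⊑ with l , j+l≡k ← m≤n⇒∃[o]m+o≡n (s≤s⁻¹ j<g) =
        subst (_OccursIn factor marked (suc a) d) (factor-filler-marker j l (c + q) (trans (+-comm l j) j+l≡k))
          (factor-occurs marked
            (≤-trans a<cg (≤-trans (*-monoˡ-≤ g (m≤m+n c q)) (m≤n+m ((c + q) * g) (suc l))))
            (≤-reflexive (begin
              suc l + (c + q) * g + suc j     ≡⟨ regroup l ((c + q) * g) j ⟩
              suc (suc (j + l) + (c + q) * g) ≡⟨ cong (λ t → suc (suc t + (c + q) * g)) j+l≡k ⟩
              suc (e * g)                     ≡⟨ cong suc end ⟨
              suc a + d                       ∎)))
        where
        open ≡-Reasoning
        regroup : ∀ l t j → suc l + t + suc j ≡ suc (suc (j + l) + t)
        regroup = solve-∀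

      absent : ¬ (candidate i j OccursIn factor marked (suc a) d)
      absent w⊑ with b , a<b , last< , first≡ , last≡ ← ends-occur-factor⁻ marked {n = d}
               (replicate j zero) (length-replicate j) w⊑
        with r , refl , r≡ ← marked-marker⁻ b (sym first≡) =
        <⇒≢ i<q (marker-cancel (<⇒≤ i<q) ≤-refl (trans (sym r≡) (cong marker r≡c+q)))
        where
        last≡eg : r * g + suc j ≡ e * g
        last≡eg = ≤-antisym (subst (r * g + suc j ≤_) end (s≤s⁻¹ last<))
          (subst (_≤ r * g + suc j) end (≮⇒≥ λ last<eg →
            new-marker _ (≤-trans (<⇒≤ a<b) (m≤m+n _ _)) last<eg (sym last≡)))
        -- Since `suc j ≤ g`, the only marker at distance `suc j` before position `e * g` can be its
        -- immediate predecessor.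
        r≡c+q : r ≡ c + q
        r≡c+q = ≤-antisym
          (s≤s⁻¹ (*-cancelʳ-< g r e (subst (r * g <_) last≡eg (m<m+n (r * g) (s≤s z≤n)))))
          (s≤s⁻¹ (*-cancelʳ-≤ e (suc r) g (begin
            e * g           ≡⟨ last≡eg ⟨
            r * g + suc j   ≤⟨ +-monoʳ-≤ (r * g) j<g ⟩
            r * g + g       ≡⟨ +-comm (r * g) g ⟩
            suc r * g       ∎)))
          where open ≤-Reasoning

    -- The first letter determines `i`, and the length determines `j`.
    candidate-injective : ∀ {i j i′ j′} → i ≤ q → i′ ≤ q →
      candidate i j ≡ candidate i′ j′ → i ≡ i′ × j ≡ j′
    candidate-injective {i} {j} {i′} {j′} i≤q i′≤q eq =
      marker-cancel i≤q i′≤q (∷-injectiveˡ eq) ,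
      (begin
        j                                     ≡⟨ length-replicate j ⟨
        length {A = Fin (suc σ)} (replicate j zero)  ≡⟨ cong length (∷ʳ-injectiveˡ _ _ (∷-injectiveʳ eq)) ⟩
        length {A = Fin (suc σ)} (replicate j′ zero) ≡⟨ length-replicate j′ ⟩
        j′                                    ∎)
      where open ≡-Reasoning

    q*g≤slideCard : q * g ≤ slideCard marked d a
    q*g≤slideCard = begin
      q * g   ≡⟨ cong₂ _*_ (length-tabulate {n = q} id) (length-tabulate {n = g} id) ⟨
      length (allFin q) * length (allFin g)  ≡⟨ length-cartesianProductWith _ (allFin q) (allFin g) ⟨
      length (cartesianProductWith cand (allFin q) (allFin g))
        ≤⟨ card-≥ (MAW-△-finite _ _)
             (cartesianProductWith⁺ cand cand-injective (allFin⁺ q) (allFin⁺ g)) cand-change ⟩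
      slideCard marked d a ∎
      where
      open ≤-Reasoning
      cand : Fin q → Fin g → String (suc σ)
      cand i j = candidate (toℕ i) (toℕ j)
      cand-injective : ∀ {i i′ j j′} → cand i j ≡ cand i′ j′ → i ≡ i′ × j ≡ j′
      cand-injective {i} {i′} eq
        with i≡ , j≡ ← candidate-injective (<⇒≤ (Fin.toℕ<n i)) (<⇒≤ (Fin.toℕ<n i′)) eq =
        Fin.toℕ-injective i≡ , Fin.toℕ-injective j≡
      cand-change : ∀ {w} → w ∈ cartesianProductWith cand (allFin q) (allFin g) →
        (MAW (factor marked a d) △ MAW (factor marked (suc a) d)) w
      cand-change w∈ with i , j , _ , _ , refl ← ∈-cartesianProductWith⁻ cand (allFin q) (allFin g) w∈ =
        change (Fin.toℕ<n i) (Fin.toℕ<n j)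

-- Choice of the word and its parameters

-- The bound is stated for the number `n ∸ d` of slides; the comparison with `n` enters only through
-- `c`.
Dense : (σ d n : ℕ) → Set
Dense σ d n = Σ[ T ∈ Vec (Fin σ) n ] ((d ⊓ σ) * (n ∸ d) ≤ 16 * 𝒮 T d)

dense-small : ∀ σ d n → 2 ≤ σ → 1 ≤ d → d < n → d ⊓ σ ≤ 16 → Dense σ d n
dense-small (suc zero) _ _ (s≤s ())
dense-small (suc (suc σ)) (suc d) n _ _ d<n m≤16 = T , (begin
  (suc d ⊓ (2 + σ)) * N     ≤⟨ *-monoˡ-≤ N m≤16 ⟩
  16 * N                    ≡⟨ cong (16 *_) (*-identityʳ N) ⟨
  16 * (N * 1)
    -- Period 1 with one change per step.
    ≤⟨ *-monoʳ-≤ 16 (𝒮-lower alternating 0 0 1 (<⇒≤ d<n) (λ _ → alternating-slideCard d _)) ⟩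
  16 * 𝒮 T (suc d)          ∎)
  where
  open ≤-Reasoning
  N = n ∸ suc d
  T = factorVec alternating 0 n

dense-large : ∀ σ d n → d < n → 16 < d ⊓ σ → Dense σ d n
dense-large zero    d n _   m>16 = contradiction (≤-trans m>16 (m⊓n≤n d 0)) λ ()
dense-large (suc σ) d n d<n m>16 = T , (begin
  m * N                     ≤⟨ *-monoˡ-≤ N m≤16q ⟩
  16 * q * N                ≡⟨ *-assoc 16 q N ⟩
  16 * (q * N)              ≡⟨ cong (16 *_) (*-comm q N) ⟩
  16 * (N * q)              ≤⟨ *-monoʳ-≤ 16 (𝒮-lower marked (d * k) k q (<⇒≤ d<n) entering) ⟩
  16 * 𝒮 T d                ∎)
  where
  open ≤-Reasoning
  m = d ⊓ suc σ
  N = n ∸ d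
  -- 4 (2 + q) ≤ p makes room for 2 + q gaps in the window, while m ≤ 16 q.
  p = pred m
  q = p / 4 ∸ 2
  instance
    p≢0 : NonZero p
    p≢0 = >-nonZero (≤-trans (s≤s z≤n) (pred-mono-≤ m>16))
  -- With gaps of length `suc k`, `p` consecutive gaps just exceed the window, so a marker returns
  -- only after its earlier copy has left.
  k = d / p
  1+p≡m : suc p ≡ m
  1+p≡m = suc-pred m {{>-nonZero (≤-trans (s≤s z≤n) m>16)}}
  16≤p : 16 ≤ p
  16≤p = pred-mono-≤ m>16
  -- Taking `p` one below `m` leaves a letter for the filler and makes `p < d`.
  p≤σ : p ≤ σ
  p≤σ = pred-mono-≤ (m⊓n≤n d (suc σ))
  p<d : p < d
  p<d = subst (_≤ d) (sym 1+p≡m) (m⊓n≤m d (suc σ))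
  2+q≡p/4 : 2 + q ≡ p / 4
  2+q≡p/4 = m+[n∸m]≡n {2} (≤-trans (s≤s (s≤s z≤n)) (/-monoˡ-≤ 4 16≤p))
  2≤q : 2 ≤ q
  2≤q = +-cancelˡ-≤ 2 2 q (subst (4 ≤_) (sym 2+q≡p/4) (/-monoˡ-≤ 4 16≤p))
  4[2+q]≤p : (2 + q) * 4 ≤ p
  4[2+q]≤p = subst (λ t → t * 4 ≤ p) (sym 2+q≡p/4) (m/n*n≤m p 4)
  p<4[3+q] : p < 4 + (2 + q) * 4
  p<4[3+q] = begin-strict
    p                     ≡⟨ m≡m%n+[m/n]*n p 4 ⟩
    p % 4 + p / 4 * 4     <⟨ +-monoˡ-< (p / 4 * 4) (m%n<n p 4) ⟩
    4 + p / 4 * 4         ≡⟨ cong (λ t → 4 + t * 4) 2+q≡p/4 ⟨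
    4 + (2 + q) * 4       ∎
  m≤16q : m ≤ 16 * q
  m≤16q = begin
    m                     ≡⟨ 1+p≡m ⟨
    suc p                 ≤⟨ p<4[3+q] ⟩
    4 + (2 + q) * 4       ≡⟨ regroup q ⟩
    -- The constant 12 is absorbed by `2 ≤ q`; this is where `16 < m` enters, as it gives
    -- `4 ≤ p / 4`.
    6 * 2 + q * 4         ≤⟨ +-monoˡ-≤ (q * 4) (*-monoʳ-≤ 6 2≤q) ⟩
    6 * q + q * 4         ≤⟨ m≤m+n _ (6 * q) ⟩
    6 * q + q * 4 + 6 * q ≡⟨ regroup′ q ⟩
    16 * q                ∎
    where
    regroup : ∀ q → 4 + (2 + q) * 4 ≡ 6 * 2 + q * 4
    regroup = solve-∀
    regroup′ : ∀ q → 6 * q + q * 4 + 6 * q ≡ 16 * q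
    regroup′ = solve-∀
  q<p : q < p
  q<p = begin-strict
    q             <⟨ m<n+m q {2} (s≤s z≤n) ⟩
    2 + q         ≤⟨ m≤m*n (2 + q) 4 ⟩
    (2 + q) * 4   ≤⟨ 4[2+q]≤p ⟩
    p             ∎
  d<p*g : d < p * suc k
  d<p*g = begin-strict
    d                 ≡⟨ m≡m%n+[m/n]*n d p ⟩
    d % p + k * p     <⟨ +-monoˡ-< (k * p) (m%n<n d p) ⟩
    suc k * p         ≡⟨ *-comm (suc k) p ⟩
    p * suc k         ∎
  q*g<d : suc q * suc k < d
  -- After doubling, the claim follows from `p * suc k ≤ p + d ≤ 2 * d`.
  q*g<d = *-cancelʳ-< 2 _ d (begin-strict
    suc q * suc k * 2             ≡⟨ *-assoc (suc q) (suc k) 2 ⟩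
    suc q * (suc k * 2)           <⟨ m<n+m (suc q * (suc k * 2)) {suc k * 2} (s≤s z≤n) ⟩
    (2 + q) * (suc k * 2)         ≤⟨ *-monoʳ-≤ (2 + q) (m≤m+n (suc k * 2) (2 + k * 2)) ⟩
    (2 + q) * (suc k * 2 + (2 + k * 2)) ≡⟨ regroup q k ⟩
    (2 + q) * 4 * suc k           ≤⟨ *-monoˡ-≤ (suc k) 4[2+q]≤p ⟩
    p * suc k                     ≡⟨ trans (*-suc p k) (cong (p +_) (*-comm p k)) ⟩
    p + k * p                     ≤⟨ +-mono-≤ (<⇒≤ p<d) (m/n*n≤m d p) ⟩
    d + d                         ≡⟨ double d ⟩
    d * 2                         ∎)
    where
    regroup : ∀ q k → (2 + q) * (suc k * 2 + (2 + k * 2)) ≡ (2 + q) * 4 * suc k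
    regroup = solve-∀
    double : ∀ d → d + d ≡ d * 2
    double = solve-∀
  1+q≤d : suc q ≤ d
  1+q≤d = ≤-trans (m≤m*n (suc q) (suc k)) (<⇒≤ q*g<d)
  open Marked p≤σ k
  T : Vec (Fin (suc σ)) n
  -- With this offset the letter after the first window stands at `d * suc k`, which is the position
  -- of marker `d`; then a marker enters every `suc k` slides, namely marker `d + t` at time
  -- `t * suc k`.
  T = factorVec marked (d * k) n
  entering : ∀ t → q * suc k ≤ slideCard marked d (d * k + t * suc k)
  entering t = Entering.q*g≤slideCard (d ∸ suc q + t) q d (d * k + t * suc k) q<p d<p*g q*g<d
    (trans (regroup d k t) (cong (_* suc k) (begin-equality
      d + t                       ≡⟨ cong (_+ t) (m∸n+n≡m 1+q≤d) ⟨
      d ∸ suc q + suc q + t       ≡⟨ rotate (d ∸ suc q) q t ⟩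
      suc (d ∸ suc q + t + q)     ∎)))
    where
    regroup : ∀ d k t → d * k + t * suc k + d ≡ (d + t) * suc k
    regroup = solve-∀
    rotate : ∀ c q t → c + suc q + t ≡ suc (c + t + q)
    rotate = solve-∀

dense : ∀ σ d n → 2 ≤ σ → 1 ≤ d → d < n → Dense σ d n
dense σ d n 2≤σ 1≤d d<n with d ⊓ σ ≤? 16
... | yes m≤16 = dense-small σ d n 2≤σ 1≤d d<n m≤16
... | no  m≰16 = dense-large σ d n d<n (≰⇒> m≰16)

-- Passage to rational constants

fromℕ-toℚᵘ : ∀ m → ℚ.toℚᵘ (fromℕ m) ℚᵘ.≃ ℤ.+ m ℚᵘ./ 1
fromℕ-toℚᵘ m = ℚₚ.toℚᵘ-fromℚᵘ (ℤ.+ m ℚᵘ./ 1)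

fromℕ-* : ∀ m n → fromℕ (m * n) ≡ fromℕ m ℚ.* fromℕ n
fromℕ-* m n = ℚₚ.toℚᵘ-injective (begin
  ℚ.toℚᵘ (fromℕ (m * n))                   ≈⟨ fromℕ-toℚᵘ (m * n) ⟩
  ℤ.+ (m * n) ℚᵘ./ 1                       ≡⟨ cong (ℚᵘ._/ 1) (ℤₚ.pos-* m n) ⟩
  ℤ.+ m ℚᵘ./ 1 ℚᵘ.* (ℤ.+ n ℚᵘ./ 1)         ≈⟨ ℚᵘₚ.*-cong (fromℕ-toℚᵘ m) (fromℕ-toℚᵘ n) ⟨
  ℚ.toℚᵘ (fromℕ m) ℚᵘ.* ℚ.toℚᵘ (fromℕ n)   ≈⟨ ℚₚ.toℚᵘ-homo-* (fromℕ m) (fromℕ n) ⟨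
  ℚ.toℚᵘ (fromℕ m ℚ.* fromℕ n)             ∎)
  where open ℚᵘₚ.≃-Reasoning

fromℕ-mono : ∀ {m n} → m ≤ n → fromℕ m ℚ.≤ fromℕ n
fromℕ-mono {m} {n} m≤n = ℚₚ.toℚᵘ-cancel-≤ (begin
  ℚ.toℚᵘ (fromℕ m)   ≃⟨ fromℕ-toℚᵘ m ⟩
  ℤ.+ m ℚᵘ./ 1       ≤⟨ ℚᵘ.*≤* (ℤₚ.*-monoʳ-≤-nonNeg (ℤ.+ 1) (ℤ.+≤+ m≤n)) ⟩
  ℤ.+ n ℚᵘ./ 1       ≃⟨ fromℕ-toℚᵘ n ⟨
  ℚ.toℚᵘ (fromℕ n)   ∎)
  where open ℚᵘₚ.≤-Reasoning

1/16 : ℚ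
1/16 = ℤ.+ 1 ℚ./ 16

-- The factor `c` pays for replacing the number `N` of slides by `n`, and `1/16` cancels the
-- constant of `Dense`.
scale-bound : ∀ c {m n N s} → c ℚ.* fromℕ n ℚ.≤ fromℕ N → m * N ≤ 16 * s →
              1/16 ℚ.* c ℚ.* fromℕ (m * n) ℚ.≤ fromℕ s
scale-bound c {m} {n} {N} {s} cn≤N mN≤16s = begin
  1/16 ℚ.* c ℚ.* fromℕ (m * n)            ≡⟨ ℚₚ.*-assoc 1/16 c (fromℕ (m * n)) ⟩
  1/16 ℚ.* (c ℚ.* fromℕ (m * n))          ≡⟨ cong (λ t → 1/16 ℚ.* (c ℚ.* t)) (swap n) ⟩
  1/16 ℚ.* (c ℚ.* (fromℕ n ℚ.* fromℕ m))  ≡⟨ cong (1/16 ℚ.*_) (ℚₚ.*-assoc c (fromℕ n) (fromℕ m)) ⟨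
  1/16 ℚ.* (c ℚ.* fromℕ n ℚ.* fromℕ m)
    ≤⟨ ℚₚ.*-monoˡ-≤-nonNeg 1/16 (ℚₚ.*-monoʳ-≤-nonNeg (fromℕ m) {{0≤m}} cn≤N) ⟩
  1/16 ℚ.* (fromℕ N ℚ.* fromℕ m)          ≡⟨ cong (1/16 ℚ.*_) (swap N) ⟨
  1/16 ℚ.* fromℕ (m * N)                  ≤⟨ ℚₚ.*-monoˡ-≤-nonNeg 1/16 (fromℕ-mono mN≤16s) ⟩
  1/16 ℚ.* fromℕ (16 * s)                 ≡⟨ cong (1/16 ℚ.*_) (fromℕ-* 16 s) ⟩
  1/16 ℚ.* (fromℕ 16 ℚ.* fromℕ s)         ≡⟨ ℚₚ.*-assoc 1/16 (fromℕ 16) (fromℕ s) ⟨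
  1/16 ℚ.* fromℕ 16 ℚ.* fromℕ s           ≡⟨⟩
  1ℚ ℚ.* fromℕ s                          ≡⟨ ℚₚ.*-identityˡ (fromℕ s) ⟩
  fromℕ s                                 ∎
  where
  open ℚₚ.≤-Reasoning
  0≤m : ℚ.NonNegative (fromℕ m)
  0≤m = ℚ.nonNegative (fromℕ-mono {0} {m} z≤n)
  swap : ∀ k → fromℕ (m * k) ≡ fromℕ k ℚ.* fromℕ m
  swap k = trans (cong fromℕ (*-comm m k)) (fromℕ-* k m)

theorem3 : (Σ[ C ∈ ℕ ] (∀ (σ d n : ℕ) → 1 ≤ d → d < n → (T : Vec (Fin σ) n) →
    𝒮 T d ≤ C * ((d ⊓ σ) * n)))
    ×
    (∀ (c : ℚ) → 0ℚ ℚ.< c → c ℚ.< 1ℚ →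
    Σ[ c′ ∈ ℚ ] (0ℚ ℚ.< c′ ×
    (∀ (σ d n : ℕ) → 2 ≤ σ → 1 ≤ d → d < n →
    c ℚ.* fromℕ n ℚ.≤ fromℕ (n ∸ d) →
    Σ[ T ∈ Vec (Fin σ) n ] (c′ ℚ.* fromℕ ((d ⊓ σ) * n) ℚ.≤ fromℕ (𝒮 T d)))))
theorem3 = (6 , λ σ → 𝒮-upper) , λ c 0<c _ →
  1/16 ℚ.* c ,
  ℚₚ.positive⁻¹ (1/16 ℚ.* c) {{ℚₚ.pos*pos⇒pos 1/16 c {{ℚ.positive 0<c}}}} ,
  λ σ d n 2≤σ 1≤d d<n cn≤n∸d → let T , bound = dense σ d n 2≤σ 1≤d d<n in
    T , scale-bound c {d ⊓ σ} {n} {n ∸ d} {𝒮 T d} cn≤n∸d bound
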